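{- Let $T$ be a minimal element of the poset $\mathcal{AFT}$. Then $T$ has two centers.
   Context: All graphs are finite and simple. A tree $T$ with $|V(T)|\ge 2$ is automorphism-free if it has no automorphism other than the identity. $\mathcal{AFT}$ is the poset whose elements are all finite automorphism-free trees (up to isomorphism), ordered by $T_1\preceq T_2$ if $T_1$ can be obtained from $T_2$ by successively deleting one leaf at a time so that each intermediate tree is also automorphism-free; a minimal element is a $T\in\mathcal{AFT}$ such that no $T'\in\mathcal{AFT}$ with $T'\neq T$ satisfies $T'\preceq T$. For a tree $T$ and $v\in V(T)$, $d_T(v)=\max_{w\in V(T)\setminus\{v\}}\mathrm{dist}_T(w,v)$, where $\mathrm{dist}_T$ is the number of edges of the unique path; $v$ is a center of $T$ if $d_T(v)\le d_T(w)$ for all $w\in V(T)$. -}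

module Defs where

open import Data.Nat using (ℕ; zero; suc; _≤_)
open import Data.Fin using (Fin; punchIn)
open import Data.Fin.Permutation using (Permutation; Permutation′; _⟨$⟩ʳ_)
open import Data.Bool using (Bool; true; false)
open import Data.List using (List; []; _∷_; length)
open import Data.List.Relation.Unary.Unique.Propositional using (Unique)
open import Data.Product using (Σ; ∃; ∃-syntax; _×_; _,_)
open import Data.Sum using (_⊎_)
open import Relation.Binary.PropositionalEquality using (_≡_; _≢_)
open import Relation.Nullary using (¬_)

record Graph (n : ℕ) : Set where
  field
    adj        : Fin n → Fin n → Bool
    adj-sym    : ∀ i j → adj i j ≡ adj j i
    adj-irrefl : ∀ i → adj i i ≡ false
open Graph public

Edge : ∀ {n} → Graph n → Fin n → Fin n → Set
Edge G i j = adj G i j ≡ true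

-- Walk G u v vs : vs is the list of vertices of a walk from u to v
-- (so the walk has length (length vs) - 1 edges).
data Walk {n} (G : Graph n) : Fin n → Fin n → List (Fin n) → Set where
  here : ∀ {u} → Walk G u u (u ∷ [])
  step : ∀ {u v w vs} → Edge G u v → Walk G v w vs → Walk G u w (u ∷ vs)

Connected : ∀ {n} → Graph n → Set
Connected {n} G = ∀ (u v : Fin n) → ∃[ vs ] Walk G u v vs

HasCycle : ∀ {n} → Graph n → Set
HasCycle {n} G = Σ (Fin n) λ u → Σ (Fin n) λ w → Σ (List (Fin n)) λ vs →
  Walk G u w vs × Unique vs × 3 ≤ length vs × Edge G w u

IsTree : ∀ {n} → Graph n → Set
IsTree G = Connected G × ¬ HasCycle G

_≅_ : ∀ {m n} → Graph m → Graph n → Set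
_≅_ {m} {n} G H = Σ (Permutation m n) λ σ →
  ∀ i j → adj H (σ ⟨$⟩ʳ i) (σ ⟨$⟩ʳ j) ≡ adj G i j

IsAutomorphism : ∀ {n} → Graph n → Permutation′ n → Set
IsAutomorphism G σ = ∀ i j → adj G (σ ⟨$⟩ʳ i) (σ ⟨$⟩ʳ j) ≡ adj G i j

AutomorphismFree : ∀ {n} → Graph n → Set
AutomorphismFree {n} G = ∀ (σ : Permutation′ n) → IsAutomorphism G σ → ∀ i → σ ⟨$⟩ʳ i ≡ i

IsAFT : ∀ {n} → Graph n → Set
IsAFT {n} T = 2 ≤ n × IsTree T × AutomorphismFree T

deleteVertex : ∀ {n} → Graph (suc n) → Fin (suc n) → Graph n
deleteVertex G ℓ = record
  { adj        = λ i j → adj G (punchIn ℓ i) (punchIn ℓ j)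
  ; adj-sym    = λ i j → adj-sym G (punchIn ℓ i) (punchIn ℓ j)
  ; adj-irrefl = λ i → adj-irrefl G (punchIn ℓ i)
  }

IsLeaf : ∀ {n} → Graph n → Fin n → Set
IsLeaf {n} G ℓ = Σ (Fin n) λ v → Edge G ℓ v × (∀ w → Edge G ℓ w → w ≡ v)

data _⪯_ : ∀ {m n} → Graph m → Graph n → Set where
  ⪯-iso : ∀ {m n} {G : Graph m} {H : Graph n} → G ≅ H → G ⪯ H
  ⪯-del : ∀ {m n} {G : Graph m} {H : Graph (suc n)} (ℓ : Fin (suc n)) →
          IsLeaf H ℓ → IsAFT (deleteVertex H ℓ) → G ⪯ deleteVertex H ℓ → G ⪯ H

MinimalAFT : ∀ {n} → Graph n → Set
MinimalAFT T = IsAFT T × (∀ {m} (T′ : Graph m) → IsAFT T′ → T′ ⪯ T → T′ ≅ T)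

Dist : ∀ {n} → Graph n → Fin n → Fin n → ℕ → Set
Dist G u v k = (∃[ vs ] (Walk G u v vs × length vs ≡ suc k))
             × (∀ vs → Walk G u v vs → suc k ≤ length vs)

Ecc : ∀ {n} → Graph n → Fin n → ℕ → Set
Ecc {n} G v e = (∀ w → w ≢ v → ∀ k → Dist G w v k → k ≤ e)
              × (Σ (Fin n) λ w → w ≢ v × Dist G w v e)

IsCenter : ∀ {n} → Graph n → Fin n → Set
IsCenter {n} G v = Σ ℕ λ e → Ecc G v e × (∀ (w : Fin n) e′ → Ecc G w e′ → e ≤ e′)

HasTwoCenters : ∀ {n} → Graph n → Set
HasTwoCenters {n} G = Σ (Fin n) λ c₁ → Σ (Fin n) λ c₂ →
  c₁ ≢ c₂ × IsCenter G c₁ × IsCenter G c₂ × (∀ c → IsCenter G c → c ≡ c₁ ⊎ c ≡ c₂)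

{-# OPTIONS --safe #-}

-- Let c be the only centre of an automorphism-free tree T, of radius r, and root T at c.  From c,
-- repeatedly descend to a child whose subtree is smallest (heights are compared first) until a leaf
-- ℓ is reached.  In T − ℓ every ancestor of ℓ is strictly smaller than its siblings, so an
-- automorphism of T − ℓ that fixes c fixes the neighbour of ℓ; it therefore extends to T and is
-- trivial.
--
-- If two vertices other than ℓ are at distance 2r, then c is still the unique centre of T − ℓ.
-- Otherwise, by the choice of ℓ, c has degree 2 and the branch of ℓ is a path; an automorphism of
-- T − ℓ that moves c exchanges c with the other centre v, so that T itself is a path, which has a
-- reflection.  Hence T − ℓ is automorphism-free and T is not minimal.
module Submission where

open import Data.Nat using (ℕ; zero; suc; _+_; _*_; _∸_; _^_; _≤_; _<_; z≤n; s≤s)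
open import Data.Nat.Properties
open import Algebra.Properties.CommutativeMonoid.Sum +-0-commutativeMonoid
  using (sum; sum-permute; sum-cong-≗)
open import Data.Bool using (if_then_else_; true; false)
import Data.Bool.Properties as Bool
open import Data.Fin using (Fin; zero; suc; punchIn; punchOut)
open import Data.Fin.Permutation as Perm
  using (Permutation′; _⟨$⟩ʳ_; _⟨$⟩ˡ_; inverseˡ; inverseʳ; flip)
import Data.Fin.Properties as Fin
open import Data.List using (List; []; _∷_; length; map; allFin)
open import Data.List.Extrema ≤-totalOrder using (argmin; argmax; f[xs]≤f[argmax]; f[argmin]≤f[xs])
open import Data.List.Membership.DecPropositional using (_∈?_)
open import Data.List.Membership.Propositional using (_∈_)
open import Data.List.Membership.Propositional.Properties using (∈-allFin)
open import Data.List.Properties using (length-map)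
open import Data.List.Relation.Unary.All as All using (All; []; _∷_)
open import Data.List.Relation.Unary.All.Properties using (¬Any⇒All¬)
open import Data.List.Relation.Unary.AllPairs using ([]; _∷_)
open import Data.List.Relation.Unary.Any using (here; there)
open import Data.List.Relation.Unary.Unique.Propositional using (Unique)
import Data.List.Relation.Unary.Unique.Propositional.Properties as Unique
open import Data.Product using (∃; ∃-syntax; _×_; _,_; proj₁; proj₂)
open import Data.Sum using (_⊎_; inj₁; inj₂; [_,_]′)
open import Function using (_∘_; mk⇔)
open import Relation.Binary.Construct.Closure.ReflexiveTransitive
  using (Star; ε; _◅_; _◅◅_) renaming (reverse to Star-reverse)
open import Relation.Binary.PropositionalEquality
open import Relation.Nullary using (¬_; Dec; yes; no; does; contradiction)
open import Relation.Nullary.Decidable using (_×-dec_; ¬?; dec-true; dec-false; map′)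
open import Relation.Unary using (Decidable)
open import Defs

-- Least witnesses, walks by length, and paths avoiding a vertex

least : ∀ {P : ℕ → Set} → Decidable P → ∀ k → P k → ∃[ m ] (P m × ∀ j → P j → m ≤ j)
least {P} P? k Pk with P? 0
... | yes p0 = 0 , p0 , λ _ _ → z≤n
least {P} P? zero    Pk | no ¬p0 = contradiction Pk ¬p0
least {P} P? (suc k) Pk | no ¬p0 with least (P? ∘ suc) k Pk
... | m , Pm , min = suc m , Pm , λ { zero p → contradiction p ¬p0 ; (suc j) p → s≤s (min j p) }

module _ {n} (G : Graph n) where

  -- Indexing by the number of edges instead of the vertex list makes existence decidable by
  -- recursion on the length (`reach?`), so that a shortest walk can be found by search.
  data Reach : ℕ → Fin n → Fin n → Set where
    stop : ∀ {u} → Reach 0 u u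
    _∷_  : ∀ {k u v w} → Edge G u v → Reach k v w → Reach (suc k) u w

  edge? : ∀ u v → Dec (Edge G u v)
  edge? u v = adj G u v Bool.≟ true

  edge-sym : ∀ {u v} → Edge G u v → Edge G v u
  edge-sym {u} {v} e = trans (adj-sym G v u) e

  edge-irrefl : ∀ {u} → ¬ Edge G u u
  edge-irrefl {u} e with trans (sym (adj-irrefl G u)) e
  ... | ()

  reach? : ∀ u w → Decidable (λ k → Reach k u w)
  reach? u w zero = map′ (λ { refl → stop }) (λ { stop → refl }) (u Fin.≟ w)
  reach? u w (suc k) =
    map′ (λ { (_ , e , r) → e ∷ r }) (λ { (e ∷ r) → _ , e , r })
         (Fin.any? (λ v → edge? u v ×-dec reach? v w k))

  walk⇒reach : ∀ {u w vs} → Walk G u w vs → ∃[ k ] (Reach k u w × length vs ≡ suc k)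
  walk⇒reach here = 0 , stop , refl
  walk⇒reach (step e w) with walk⇒reach w
  ... | k , r , eq = suc k , e ∷ r , cong suc eq

  reach⇒walk : ∀ {k u w} → Reach k u w → ∃[ vs ] (Walk G u w vs × length vs ≡ suc k)
  reach⇒walk stop = _ , here , refl
  reach⇒walk (e ∷ r) with reach⇒walk r
  ... | vs , w , eq = _ , step e w , cong suc eq

  reach-++ : ∀ {j k u v w} → Reach j u v → Reach k v w → Reach (j + k) u w
  reach-++ stop    s = s
  reach-++ (e ∷ r) s = e ∷ reach-++ r s

  reach-reverse : ∀ {k u w} → Reach k u w → Reach k w u
  reach-reverse stop = stop
  reach-reverse {suc k} {u} {w} (e ∷ r) =
    subst (λ j → Reach j w u) (+-comm k 1) (reach-++ (reach-reverse r) (edge-sym e ∷ stop))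

  PathAvoiding : Fin n → Fin n → Fin n → Set
  PathAvoiding u a b = ∃[ vs ] (Walk G a b vs × Unique vs × All (u ≢_) vs)

  path-suffix : ∀ {u a x b vs} → a ∈ vs → Walk G x b vs → Unique vs → All (u ≢_) vs →
                PathAvoiding u a b
  path-suffix (here refl) here       q         av       = _ , here , q , av
  path-suffix (here refl) (step e w) q         av       = _ , step e w , q , av
  path-suffix (there a∈)  (step e w) (_ ∷ q) (_ ∷ av)   = path-suffix a∈ w q av

  -- Loop erasure: if `a` already lies on the path, the suffix starting at `a` replaces the
  -- prolonged path.
  path-cons : ∀ {u a x b} → u ≢ a → Edge G a x → PathAvoiding u x b → PathAvoiding u a b
  path-cons {a = a} u≢a e (vs , w , q , av) with _∈?_ Fin._≟_ a vs
  ... | yes a∈ = path-suffix a∈ w q av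
  ... | no  a∉ = _ , step e w , ¬Any⇒All¬ vs a∉ ∷ q , u≢a ∷ av

  EdgeAvoiding : Fin n → Fin n → Fin n → Set
  EdgeAvoiding u a b = Edge G a b × u ≢ a × u ≢ b

  star⇒path : ∀ {u a b} → u ≢ b → Star (EdgeAvoiding u) a b → PathAvoiding u a b
  star⇒path u≢b ε                    = _ , here , [] ∷ [] , u≢b ∷ []
  star⇒path u≢b ((e , u≢a , _) ◅ s) = path-cons u≢a e (star⇒path u≢b s)

  -- A walk between two neighbours of u that avoids u would close up to a cycle through u.
  neighbours-separated : ¬ HasCycle G → ∀ {u v v′} → Edge G u v → Edge G u v′ → u ≢ v′ →
                         Star (EdgeAvoiding u) v v′ → v ≡ v′
  neighbours-separated acyc e e′ u≢v′ s with star⇒path u≢v′ s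
  ... | _ , here , q , av = refl
  ... | _ , step {vs = []} _ () , q , av
  ... | _ , w@(step {vs = _ ∷ _} _ _) , q , av =
    contradiction (_ , _ , _ , step e w , av ∷ q , s≤s (s≤s (s≤s z≤n)) , edge-sym e′) acyc

-- The path metric of a tree

module Metric {n} (G : Graph n) (tree : IsTree G) where

  private
    shortest : ∀ u w → ∃[ m ] (Reach G m u w × ∀ j → Reach G j u w → m ≤ j)
    shortest u w with walk⇒reach G (proj₂ (proj₁ tree u w))
    ... | k , r , _ = least (reach? G u w) k r

  abstract
    d : Fin n → Fin n → ℕ
    d u w = proj₁ (shortest u w)

    d-reach : ∀ u w → Reach G (d u w) u w
    d-reach u w = proj₁ (proj₂ (shortest u w))

    d-least : ∀ {k u w} → Reach G k u w → d u w ≤ k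
    d-least {k} {u} {w} = proj₂ (proj₂ (shortest u w)) k

  d-refl : ∀ u → d u u ≡ 0
  d-refl u = n≤0⇒n≡0 (d-least stop)

  d≡0⇒≡ : ∀ {u w} → d u w ≡ 0 → u ≡ w
  d≡0⇒≡ {u} {w} eq with stop ← subst (λ k → Reach G k u w) eq (d-reach u w) = refl

  d-sym : ∀ u w → d u w ≡ d w u
  d-sym u w = ≤-antisym (d-least (reach-reverse G (d-reach w u))) (d-least (reach-reverse G (d-reach u w)))

  d-triangle : ∀ u v w → d u w ≤ d u v + d v w
  d-triangle u v w = d-least (reach-++ G (d-reach u v) (d-reach v w))

  d-step : ∀ {u v} w → Edge G u v → d u w ≤ suc (d v w)
  d-step w e = d-least (e ∷ d-reach _ w)

  abstract
    toward : ∀ {u w} → u ≢ w → ∃[ v ] (Edge G u v × suc (d v w) ≡ d u w)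
    toward {u} {w} u≢w with d u w in eq | d-reach u w
    ... | zero  | stop = contradiction refl u≢w
    ... | suc k | e ∷ r = _ , e , cong suc (≤-antisym (d-least r)
                            (≤-pred (subst (_≤ _) eq (d-step w e))))

  dist⇒d : ∀ {u w k} → Dist G u w k → k ≡ d u w
  dist⇒d {u} {w} {k} ((vs , wk , eq) , min) with walk⇒reach G wk | reach⇒walk G (d-reach u w)
  ... | j , r , eq′ | vs″ , wk″ , eq″ =
    ≤-antisym (≤-pred (≤-trans (min vs″ wk″) (≤-reflexive eq″)))
              (subst (d u w ≤_) (suc-injective (trans (sym eq′) eq)) (d-least r))

  d-dist : ∀ u w → Dist G u w (d u w)
  d-dist u w = reach⇒walk G (d-reach u w) , λ vs wk → helper vs wk
    where
    helper : ∀ vs → Walk G u w vs → suc (d u w) ≤ length vs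
    helper vs wk with walk⇒reach G wk
    ... | k , r , eq = subst (suc (d u w) ≤_) (sym eq) (s≤s (d-least r))

  private
    descend : ∀ {u w} k {v} → d v w ≡ k → u ≢ v → d v w ≤ d u w → Star (EdgeAvoiding G u) v w
    descend zero eq u≢v le rewrite d≡0⇒≡ eq = ε
    descend {u} {w} (suc k) {v} eq u≢v le with v Fin.≟ w
    ... | yes refl = ε
    ... | no v≢w with toward v≢w
    ... | v′ , e , eq′ = (e , u≢v , u≢v′) ◅ descend k (suc-injective (trans eq′ eq)) u≢v′ (<⇒≤ lt)
      where
      lt : d v′ w < d u w
      lt = ≤-trans (≤-reflexive eq′) le
      u≢v′ : u ≢ v′
      u≢v′ refl = <-irrefl refl lt

  -- Descents from `v` and from `v′` to `w` never meet `u`: the first vertex is a neighbour of `u`,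
  -- and all later ones are strictly closer to `w` than `u` is. Joined at `w`, they connect two
  -- neighbours of `u` off `u`.
  at-most-one-toward : ∀ {u v v′ w} → Edge G u v → Edge G u v′ → d v w ≤ d u w → d v′ w ≤ d u w → v ≡ v′
  at-most-one-toward {u} {v} {v′} {w} e e′ le le′ =
    neighbours-separated G (proj₂ tree) e e′ u≢v′
      (descend _ refl u≢v le ◅◅ Star-reverse rev (descend _ refl u≢v′ le′))
    where
    rev : ∀ {a b} → EdgeAvoiding G u a b → EdgeAvoiding G u b a
    rev (e , p , q) = edge-sym G e , q , p
    u≢v : u ≢ v
    u≢v refl = edge-irrefl G e
    u≢v′ : u ≢ v′
    u≢v′ refl = edge-irrefl G e′

  toward-unique : ∀ {u v v′ w} → Edge G u v → Edge G u v′ →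
                  suc (d v w) ≡ d u w → suc (d v′ w) ≡ d u w → v ≡ v′
  toward-unique e e′ eq eq′ =
    at-most-one-toward e e′ (≤-trans (n≤1+n _) (≤-reflexive eq)) (≤-trans (n≤1+n _) (≤-reflexive eq′))

  -- A neighbour of `u` that is no farther from `w` than `u` must be the next vertex towards `w`, so
  -- the two ends of an edge are never equidistant from `w`.
  edge-cases : ∀ {u v} w → Edge G u v → suc (d u w) ≡ d v w ⊎ suc (d v w) ≡ d u w
  edge-cases {u} {v} w e with u Fin.≟ w
  ... | yes refl = inj₁ (trans (cong suc (d-refl u)) (≤-antisym
                     (n≢0⇒n>0 λ eq → edge-irrefl G (subst (λ z → Edge G u z) (d≡0⇒≡ eq) e))
                     (≤-trans (d-step u (edge-sym G e)) (s≤s (≤-reflexive (d-refl u))))))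
  ... | no u≢w with d v w ≤? d u w | toward u≢w
  ... | no  v≰u | _ = inj₁ (≤-antisym (≰⇒> v≰u) (d-step w (edge-sym G e)))
  ... | yes v≤u | p , e′ , eq =
    inj₂ (subst (λ z → suc (d z w) ≡ d u w)
           (at-most-one-toward e′ e (≤-trans (n≤1+n _) (≤-reflexive eq)) v≤u) eq)

-- Points on geodesics

module Geodesics {n} (G : Graph n) (tree : IsTree G) where
  open Metric G tree

  -- Membership of the path from `a` to `b`, encoded as equality in the triangle inequality; this is
  -- decidable and turns arguments about paths into arithmetic.
  Between : Fin n → Fin n → Fin n → Set
  Between a x b = d a x + d x b ≡ d a b

  between-intro : ∀ {a x b} → d a x + d x b ≤ d a b → Between a x b
  between-intro {a} {x} {b} le = ≤-antisym le (d-triangle a x b)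

  between-left : ∀ a b → Between a a b
  between-left a b = cong (_+ d a b) (d-refl a)

  between-right : ∀ a b → Between a b b
  between-right a b = trans (cong (d a b +_) (d-refl b)) (+-identityʳ _)

  between-trans : ∀ {a x y z} → Between a x y → Between a y z → Between a x z
  between-trans {a} {x} {y} {z} p q = between-intro (begin
    d a x + d x z           ≤⟨ +-monoʳ-≤ (d a x) (d-triangle x y z) ⟩
    d a x + (d x y + d y z) ≡⟨ +-assoc (d a x) _ _ ⟨
    d a x + d x y + d y z   ≡⟨ cong (_+ d y z) p ⟩
    d a y + d y z           ≡⟨ q ⟩
    d a z                   ∎)
    where open ≤-Reasoning

  between-forward : ∀ {a x y b} → Between a x b → Edge G x y → suc (d y b) ≡ d x b →
                    d a y ≡ suc (d a x) × Between a y b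
  between-forward {a} {x} {y} {b} btw e eq = lvl , trans (trans (cong (_+ d y b) lvl) shift) btw
    where
    shift : suc (d a x) + d y b ≡ d a x + d x b
    shift = trans (sym (+-suc _ _)) (cong (d a x +_) eq)
    lvl : d a y ≡ suc (d a x)
    lvl = ≤-antisym
      (subst₂ _≤_ (d-sym y a) (cong suc (d-sym x a)) (d-step a (edge-sym G e)))
      (+-cancelʳ-≤ (d y b) _ _ (≤-trans (≤-reflexive (trans shift btw)) (d-triangle a y b)))

  -- By induction on the distance to `b`, the successors of `x` and `y` towards `b` coincide; then
  -- `x` and `y` are both the next vertex from that common successor back to `a`.
  geodesic-point-unique : ∀ {a b x y} → Between a x b → d a x ≡ d a y → d x b ≡ d y b → x ≡ y
  geodesic-point-unique {a} {b} btw eq₁ eq₂ = go _ btw eq₁ refl (sym eq₂)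
    where
    go : ∀ j {x y} → Between a x b → d a x ≡ d a y → d x b ≡ j → d y b ≡ j → x ≡ y
    go zero btw _ p q = trans (d≡0⇒≡ p) (sym (d≡0⇒≡ q))
    go (suc j) {x} {y} btw eq p q
      with toward {x} {b} (λ { refl → 0≢1+n (trans (sym (d-refl b)) p) })
         | toward {y} {b} (λ { refl → 0≢1+n (trans (sym (d-refl b)) q) })
    ... | x′ , ex , dx | y′ , ey , dy
      with between-forward btw ex dx
         | between-forward (trans (cong₂ _+_ (sym eq) (trans q (sym p))) btw) ey dy
    ... | lx , bx | ly , by
      with go j bx (trans lx (trans (cong suc eq) (sym ly)))
             (suc-injective (trans dx p)) (suc-injective (trans dy q))
    ... | refl = toward-unique {w = a} (edge-sym G ex) (edge-sym G ey)
                   (flip-lvl lx) (flip-lvl ly)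
      where
      flip-lvl : ∀ {u v} → d a v ≡ suc (d a u) → suc (d u a) ≡ d v a
      flip-lvl {u} {v} l = trans (cong suc (d-sym u a)) (trans (sym l) (d-sym a v))

  abstract
    geodesic-level : ∀ {a b} k → k ≤ d a b → ∃[ x ] (d a x ≡ k × Between a x b)
    geodesic-level {a} {b} zero le = a , d-refl a , between-left a b
    geodesic-level {a} {b} (suc k) le with geodesic-level k (<⇒≤ le)
    ... | x , lvl , btw with toward {x} {b} (λ { refl → <-irrefl (sym lvl) le })
    ... | y , e , eq with between-forward btw e eq
    ... | lvl′ , btw′ = y , trans lvl′ (cong suc lvl) , btw′

  -- The vertex of the path from `a` to `y` at the level of `x` also lies on the path from `a` to
  -- `z`, where a level determines the vertex; hence it is `x`.
  between-comparable : ∀ {a x y z} → Between a x z → Between a y z → d a x ≤ d a y → Between a x y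
  between-comparable {a} {x} {y} {z} bx by le with geodesic-level {a} {y} (d a x) le
  ... | x′ , lvl , btw with between-trans btw by
  ... | btw′ with geodesic-point-unique btw′ lvl
                    (+-cancelˡ-≡ (d a x′) _ _ (trans btw′ (trans (sym bx) (cong (_+ d x z) (sym lvl)))))
  ... | refl = btw

  -- Removing the edge `c v` leaves `x` on the side of `v` and `y` on the side of `c`, so the path
  -- joining them uses that edge. The induction moves `y` away from `c`. If the step from `y′` to
  -- `y` came closer to `x`, it would be the step from `y′` towards `x`: for `y′` equal to `c` this
  -- leads to `v`, on the wrong side, and otherwise it leads back towards `c`.
  between-glue : ∀ {c v x y} → Edge G c v → suc (d v x) ≡ d c x → suc (d c y) ≡ d v y → Between x c y
  between-glue {c} {v} {x} e ex = go _ refl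
    where
    go : ∀ k {y} → d y c ≡ k → suc (d c y) ≡ d v y → Between x c y
    go zero p ey rewrite d≡0⇒≡ p = between-right x c
    go (suc k) {y} p ey with toward {y} {c} (λ { refl → 0≢1+n (trans (sym (d-refl y)) p) })
    ... | y′ , e′ , eq′ with go k (suc-injective (trans eq′ p)) ey′
      where
      ey′ : suc (d c y′) ≡ d v y′
      -- If `y′` were on the side of `v`, then `d v y` would be at most `d c y′`, which is less than
      -- `d c y`.
      ey′ with edge-cases y′ e
      ... | inj₁ q = q
      ... | inj₂ q = contradiction
        (begin-strict
          suc (d c y)         ≡⟨ ey ⟩
          d v y               ≤⟨ d-triangle v y′ y ⟩
          d v y′ + d y′ y     ≤⟨ +-monoʳ-≤ (d v y′) (subst (_≤ 1) (d-sym y y′)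
                                   (≤-trans (d-step y′ e′) (s≤s (≤-reflexive (d-refl y′))))) ⟩
          d v y′ + 1          ≡⟨ +-comm _ 1 ⟩
          suc (d v y′)        ≡⟨ q ⟩
          d c y′              <⟨ ≤-reflexive (trans (cong suc (d-sym c y′)) (trans eq′ (d-sym y c))) ⟩
          d c y               ≤⟨ n≤1+n _ ⟩
          suc (d c y)         ∎) (<-irrefl refl)
        where open ≤-Reasoning
    ... | ih with edge-cases x e′
    ... | inj₂ q = begin
        d x c + d c y        ≡⟨ cong (d x c +_) (trans (d-sym c y) (trans (sym eq′) (cong suc (d-sym y′ c)))) ⟩
        d x c + suc (d c y′) ≡⟨ +-suc _ _ ⟩
        suc (d x c + d c y′) ≡⟨ cong suc ih ⟩
        suc (d x y′)         ≡⟨ cong suc (d-sym x y′) ⟩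
        suc (d y′ x)         ≡⟨ q ⟩
        d y x                ≡⟨ d-sym y x ⟩
        d x y                ∎
        where open ≡-Reasoning
    ... | inj₁ q with y′ Fin.≟ c
    ... | yes refl with toward-unique (edge-sym G e′) e q ex
    ... | refl = contradiction (trans ey (d-refl y)) λ ()
    go (suc k) {y} p ey | y′ , e′ , eq′ | ih | inj₁ q | no y′≢c with toward y′≢c
    ... | y″ , e″ , eq″ with toward-unique (edge-sym G e′) e″ q toward-x
      where
      toward-x : suc (d y″ x) ≡ d y′ x
      toward-x = ≤-antisym
        (begin
          suc (d y″ x)         ≤⟨ s≤s (d-triangle y″ c x) ⟩
          suc (d y″ c) + d c x ≡⟨ cong (_+ d c x) eq″ ⟩
          d y′ c + d c x       ≡⟨ cong₂ _+_ (d-sym y′ c) (d-sym c x) ⟩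
          d c y′ + d x c       ≡⟨ +-comm (d c y′) _ ⟩
          d x c + d c y′       ≡⟨ ih ⟩
          d x y′               ≡⟨ d-sym x y′ ⟩
          d y′ x               ∎) (d-step x e″)
        where open ≤-Reasoning
    ... | refl = contradiction (trans (cong suc eq″) eq′) (<⇒≢ (s≤s (n≤1+n _)) ∘ sym)

-- Eccentricities and centres

module Centres {n} (G : Graph n) (tree : IsTree G) where
  open Metric G tree
  open Geodesics G tree

  abstract
    far : Fin n → Fin n
    far v = argmax (d v) v (allFin n)

    d≤far : ∀ v w → d v w ≤ d v (far v)
    d≤far v w = All.lookup (f[xs]≤f[argmax] {f = d v} v (allFin n)) (∈-allFin w)

  ecc : Fin n → ℕ
  ecc v = d v (far v)

  d≤ecc : ∀ v w → d v w ≤ ecc v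
  d≤ecc = d≤far

  Central : Fin n → Set
  Central c = ∀ w → ecc c ≤ ecc w

  abstract
    central-vertex : Fin n → ∃ Central
    central-vertex v = argmin ecc v (allFin n) , λ w →
      All.lookup (f[argmin]≤f[xs] {f = ecc} v (allFin n)) (∈-allFin w)

  ecc-unique : ∀ {v k} → Ecc G v k → k ≡ ecc v
  ecc-unique {v} {k} (upper , w , w≢v , dist) = ≤-antisym
    (subst (_≤ ecc v) (trans (d-sym v w) (sym (dist⇒d dist))) (d≤ecc v w)) le
    where
    le : ecc v ≤ k
    le with far v Fin.≟ v
    ... | yes eq = ≤-trans (≤-reflexive (trans (cong (d v) eq) (d-refl v))) z≤n
    ... | no far≢v = upper (far v) far≢v _ (subst (Dist G (far v) v) (d-sym (far v) v) (d-dist (far v) v))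

  module _ (nontrivial : ∀ (v : Fin n) → ∃[ w ] w ≢ v) where

    -- A second vertex is required because `Ecc` asks for a farthest vertex distinct from `v`.
    ecc-Ecc : ∀ v → Ecc G v (ecc v)
    ecc-Ecc v = (λ w _ k dist → subst (_≤ ecc v) (trans (d-sym v w) (sym (dist⇒d dist))) (d≤ecc v w))
              , far v , far≢v , subst (Dist G (far v) v) (d-sym (far v) v) (d-dist (far v) v)
      where
      far≢v : far v ≢ v
      far≢v eq with nontrivial v
      ... | w , w≢v = w≢v (sym (d≡0⇒≡ (n≤0⇒n≡0
            (subst (d v w ≤_) (trans (cong (d v) eq) (d-refl v)) (d≤ecc v w)))))

    central⇒IsCenter : ∀ {c} → Central c → IsCenter G c
    central⇒IsCenter {c} central =
      ecc c , ecc-Ecc c , λ w e′ Ew → subst (ecc c ≤_) (sym (ecc-unique Ew)) (central w)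

    IsCenter⇒central : ∀ {c} → IsCenter G c → Central c
    IsCenter⇒central (e , Ec , min) w = subst (_≤ ecc w) (ecc-unique Ec) (min w (ecc w) (ecc-Ecc w))

    module _ {c} (central : Central c) where
      private
        r = ecc c
        w₀ = far c

      far≢ : c ≢ w₀
      far≢ eq = proj₁ (proj₂ (proj₂ (ecc-Ecc c))) (sym eq)

      private
        v₀ = proj₁ (toward far≢)
        e₀ = proj₁ (proj₂ (toward far≢))
        eq₀ = proj₂ (proj₂ (toward far≢))

      -- All vertices at distance ecc c from c lie in the direction of any other central vertex.
      other-central : ∀ {c′} → Central c′ → c′ ≡ c ⊎ c′ ≡ v₀
      other-central {c′} central′ with c Fin.≟ c′
      ... | yes eq = inj₁ (sym eq)
      ... | no c≢c′ with toward c≢c′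
      ... | v , e , eq = inj₂ (trans (sym v≡c′) v≡v₀)
        where
        near : ∀ {w} → suc (d c w) ≡ d v w → d c′ c + d c w ≤ r
        -- The path from `c′` to a vertex on the side of `c` passes through `c`, and its length is
        -- at most the eccentricity of `c′`, which is at most `r`.
        near ew = ≤-trans (≤-reflexive (between-glue e eq ew)) (≤-trans (d≤ecc c′ _) (central′ c))
        v≡v₀ : v ≡ v₀
        v≡v₀ with edge-cases w₀ e
        ... | inj₂ q = toward-unique e e₀ q eq₀
        ... | inj₁ q = contradiction
          (≤-trans (+-monoˡ-≤ r (n≢0⇒n>0 (c≢c′ ∘ sym ∘ d≡0⇒≡))) (near q)) (<-irrefl refl)
        v≡c′ : v ≡ c′
        -- A vertex farthest from `v` lies on the side of `c`, since otherwise its distance to `c`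
        -- would exceed `r`. Its distance to `v` is at least `r`, so `near` leaves no room between
        -- `v` and `c′`.
        v≡c′ with edge-cases (far v) e
        ... | inj₂ q = contradiction
                (≤-trans (s≤s (central v)) (≤-trans (≤-reflexive q) (d≤ecc c (far v)))) (<-irrefl refl)
        ... | inj₁ q = d≡0⇒≡ (n≤0⇒n≡0 (+-cancelʳ-≤ r _ 0 (begin
              d v c′ + r                   ≤⟨ +-monoʳ-≤ (d v c′) (central v) ⟩
              d v c′ + ecc v               ≡⟨ cong (d v c′ +_) q ⟨
              d v c′ + suc (d c (far v))   ≡⟨ +-suc _ _ ⟩
              suc (d v c′) + d c (far v)   ≡⟨ cong (_+ d c (far v)) (trans eq (d-sym c c′)) ⟩
              d c′ c + d c (far v)         ≤⟨ near q ⟩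
              r                            ∎)))
          where open ≤-Reasoning

      -- The vertex `v₀` is the next one from `c` towards `w₀`. If its eccentricity is at most `r`,
      -- it is the second centre. Otherwise a vertex farthest from `v₀` lies beyond `c` at distance
      -- `r` from it, which makes `c` the midpoint of a path of length `2r`.
      two-centres-or-diametral-pair : HasTwoCenters G ⊎ (∃[ w₁ ] (Between w₀ c w₁ × d c w₁ ≡ r))
      two-centres-or-diametral-pair with ecc v₀ ≤? r
      ... | yes le = inj₁ (c , v₀ , (λ c≡v₀ → edge-irrefl G (subst (Edge G c) (sym c≡v₀) e₀))
                          , central⇒IsCenter central
                          , central⇒IsCenter (λ w → ≤-trans le (central w))
                          , λ c′ C → other-central (IsCenter⇒central C))
      ... | no gt with edge-cases (far v₀) e₀
      ... | inj₁ q = inj₂ (far v₀ , between-glue e₀ eq₀ q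
                          , ≤-antisym (d≤ecc c _) (≤-pred (subst (suc r ≤_) (sym q) (≰⇒> gt))))
      ... | inj₂ q = contradiction (≤-trans (n≤1+n _) (≤-trans (≤-reflexive q) (d≤ecc c _))) gt

-- Finite minimisation and sums

minimiser : ∀ {n} {P : Fin n → Set} → Decidable P → (f : Fin n → ℕ) → ∃ P →
            ∃[ x ] (P x × ∀ y → P y → f x ≤ f y)
minimiser {P = P} P? f (x , Px)
  with least (λ k → Fin.any? (λ y → P? y ×-dec f y ≟ k)) (f x) (x , Px , refl)
... | _ , (y , Py , refl) , min = y , Py , λ z Pz → min (f z) (z , Pz , refl)

sum-mono-≤ : ∀ {n} {f g : Fin n → ℕ} → (∀ i → f i ≤ g i) → sum f ≤ sum g
sum-mono-≤ {zero}  le = z≤n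
sum-mono-≤ {suc n} le = +-mono-≤ (le zero) (sum-mono-≤ (le ∘ suc))

sum-mono-< : ∀ {n} {f g : Fin n → ℕ} → (∀ i → f i ≤ g i) → ∀ i → f i < g i → sum f < sum g
sum-mono-< le zero    lt = +-mono-<-≤ lt (sum-mono-≤ (le ∘ suc))
sum-mono-< le (suc i) lt = +-mono-≤-< (le zero) (sum-mono-< (le ∘ suc) i lt)

term≤sum : ∀ {n} (f : Fin n → ℕ) i → f i ≤ sum f
term≤sum f zero    = m≤m+n _ _
term≤sum f (suc i) = ≤-trans (term≤sum (f ∘ suc) i) (m≤n+m _ _)

sum-bound : ∀ {n b} m (f : Fin n → ℕ) → (∀ i → m * f i ≤ b) → m * sum f ≤ n * b
sum-bound {zero}  m f le = ≤-reflexive (*-zeroʳ m)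
sum-bound {suc n} m f le =
  ≤-trans (≤-reflexive (*-distribˡ-+ m (f zero) _)) (+-mono-≤ (le zero) (sum-bound m (f ∘ suc) (le ∘ suc)))

+-squeeze : ∀ {a b r s} → a ≤ r → b ≤ s → r + s ≤ a + b → a ≡ r × b ≡ s
+-squeeze {a} {b} {r} {s} a≤r b≤s le =
    ≤-antisym a≤r (+-cancelʳ-≤ s r a (≤-trans le (+-monoʳ-≤ a b≤s)))
  , ≤-antisym b≤s (+-cancelˡ-≤ r s b (≤-trans le (+-monoˡ-≤ b a≤r)))

-- Rooted trees, subtree sizes and the greedy leaf

module Rooted {n} (G : Graph n) (tree : IsTree G) (c : Fin n) where
  open Metric G tree
  open Geodesics G tree
  open Centres G tree

  infix 4 _⊑_

  -- The ancestor order of the tree rooted at `c`.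
  _⊑_ : Fin n → Fin n → Set
  x ⊑ y = Between c x y

  _⊑?_ : ∀ x y → Dec (x ⊑ y)
  x ⊑? y = d c x + d x y ≟ d c y

  root-⊑ : ∀ x → c ⊑ x
  root-⊑ = between-left c

  ⊑-refl : ∀ x → x ⊑ x
  ⊑-refl = between-right c

  ⊑-level : ∀ {x y} → x ⊑ y → d c x ≤ d c y
  ⊑-level {x} {y} p = ≤-trans (m≤m+n _ _) (≤-reflexive p)

  ⊑-level-≡ : ∀ {x y} → x ⊑ y → d c y ≤ d c x → x ≡ y
  ⊑-level-≡ {x} {y} p le = d≡0⇒≡ (n≤0⇒n≡0 (+-cancelˡ-≤ (d c x) _ 0
    (≤-trans (≤-reflexive p) (≤-trans le (≤-reflexive (sym (+-identityʳ _)))))))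

  ⊑-point-unique : ∀ {x y z} → x ⊑ z → y ⊑ z → d c x ≡ d c y → x ≡ y
  ⊑-point-unique p q eq = ⊑-level-≡ (between-comparable p q (≤-reflexive eq)) (≤-reflexive (sym eq))

  Child : Fin n → Fin n → Set
  Child u v = Edge G u v × d c v ≡ suc (d c u)

  child? : ∀ u v → Dec (Child u v)
  child? u v = edge? G u v ×-dec d c v ≟ suc (d c u)

  edge⇒child : ∀ {u v} → Edge G u v → Child u v ⊎ Child v u
  edge⇒child {u} {v} e with edge-cases c e
  ... | inj₁ q = inj₁ (e , trans (d-sym c v) (trans (sym q) (cong suc (d-sym u c))))
  ... | inj₂ q = inj₂ (edge-sym G e , trans (d-sym c u) (trans (sym q) (cong suc (d-sym v c))))

  child-⊑ : ∀ {u v} → Child u v → u ⊑ v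
  child-⊑ {u} {v} (e , eq) = between-intro (begin
    d c u + d u v ≤⟨ +-monoʳ-≤ (d c u) (d-step v e) ⟩
    d c u + suc (d v v) ≡⟨ cong (λ k → d c u + suc k) (d-refl v) ⟩
    d c u + 1 ≡⟨ +-comm _ 1 ⟩
    suc (d c u) ≡⟨ eq ⟨
    d c v ∎)
    where open ≤-Reasoning

  parent-unique : ∀ {u u′ v} → Child u v → Child u′ v → u ≡ u′
  parent-unique {u} {u′} {v} (e , eq) (e′ , eq′) =
    toward-unique {w = c} (edge-sym G e) (edge-sym G e′)
      (trans (cong suc (d-sym u c)) (trans (sym eq) (d-sym c v)))
      (trans (cong suc (d-sym u′ c)) (trans (sym eq′) (d-sym c v)))

  abstract
    parent : ∀ {v} → v ≢ c → ∃[ u ] Child u v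
    parent {v} v≢c with toward v≢c
    ... | u , e , eq = u , edge-sym G e , trans (d-sym c v) (trans (sym eq) (cong suc (d-sym u c)))

  ⊑-parent : ∀ {a z y} → a ⊑ y → Child z y → a ≡ y ⊎ a ⊑ z
  ⊑-parent {a} {z} {y} p ch with d c a ≤? d c z
  ... | yes le = inj₂ (between-comparable p (child-⊑ ch) le)
  ... | no gt  = inj₁ (⊑-level-≡ p (≤-trans (≤-reflexive (proj₂ ch)) (≰⇒> gt)))

  siblings-disjoint : ∀ {z a b x} → Child z a → Child z b → a ⊑ x → b ⊑ x → a ≡ b
  siblings-disjoint (_ , p) (_ , q) a⊑x b⊑x = ⊑-point-unique a⊑x b⊑x (trans p (sym q))

  abstract
    child-toward : ∀ {z x} → z ⊑ x → z ≢ x → ∃[ a ] (Child z a × a ⊑ x)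
    child-toward {z} {x} z⊑x z≢x with toward z≢x
    ... | a , e , eq with between-forward z⊑x e eq
    ... | lvl , a⊑x = a , (e , lvl) , a⊑x

  -- Weights grow fast enough for the size of a subtree to compare heights first.
  weight : ℕ → ℕ
  weight k = suc n ^ k

  -- Depending on three distances only, it is invariant under every map that preserves these; the
  -- test is the one deciding `⊑`.
  term : ℕ → ℕ → ℕ → ℕ
  term i j k = if does (i + j ≟ k) then weight j else 0

  contribution : Fin n → Fin n → ℕ
  contribution v w = term (d c v) (d v w) (d c w)

  size : Fin n → ℕ
  size v = sum (contribution v)

  contribution-⊑ : ∀ {v w} → v ⊑ w → contribution v w ≡ weight (d v w)
  contribution-⊑ {v} {w} p rewrite dec-true (v ⊑? w) p = refl

  contribution-⋢ : ∀ {v w} → ¬ v ⊑ w → contribution v w ≡ 0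
  contribution-⋢ {v} {w} p rewrite dec-false (v ⊑? w) p = refl

  weight-pos : ∀ k → 0 < weight k
  weight-pos k = m^n>0 (suc n) k

  -- If every descendant of `b` had depth below `h = d a x`, each would contribute at most
  -- `suc n ^ (h - 1)` to `size b`, and `n` such terms stay below the single contribution of `x` to
  -- `size a`. The inequalities are multiplied by `suc n` to avoid the subtraction.
  size-≤⇒height-≤ : ∀ {a b x} → size a ≤ size b → a ⊑ x → ∃[ y ] (b ⊑ y × d a x ≤ d b y)
  size-≤⇒height-≤ {a} {b} {x} le a⊑x with Fin.any? (λ y → b ⊑? y ×-dec d a x ≤? d b y)
  ... | yes found = found
  ... | no none = contradiction (begin-strict
      suc n * weight (d a x)    ≡⟨ cong (suc n *_) (contribution-⊑ a⊑x) ⟨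
      suc n * contribution a x  ≤⟨ *-monoʳ-≤ (suc n) (term≤sum (contribution a) x) ⟩
      suc n * size a            ≤⟨ *-monoʳ-≤ (suc n) le ⟩
      suc n * size b            ≤⟨ sum-bound (suc n) (contribution b) small ⟩
      n * weight (d a x)        <⟨ +-monoˡ-≤ _ (weight-pos (d a x)) ⟩
      suc n * weight (d a x)    ∎) (<-irrefl refl)
    where
    open ≤-Reasoning
    small : ∀ y → suc n * contribution b y ≤ weight (d a x)
    small y with b ⊑? y
    ... | no b⋢y = ≤-trans (≤-reflexive (trans (cong (suc n *_) (contribution-⋢ b⋢y)) (*-zeroʳ (suc n)))) z≤n
    ... | yes b⊑y = ≤-trans (≤-reflexive (cong (suc n *_) (contribution-⊑ b⊑y)))
                      (^-monoʳ-≤ (suc n) (≰⇒> (λ le → none (y , b⊑y , le))))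

  Greedy : Fin n → Set
  Greedy x = ∀ {z a b} → Child z a → a ⊑ x → Child z b → size a ≤ size b

  Childless : Fin n → Set
  Childless x = ∀ y → ¬ Child x y

  abstract
    greedy-descent : ∃[ ℓ ] (Greedy ℓ × Childless ℓ)
    -- No child lies above the root, so `Greedy c` holds vacuously. Each step goes down one level,
    -- so `ecc c` steps suffice.
    greedy-descent = go (ecc c) c
        (λ {z} {a} (_ , lvl) a⊑c → contradiction
          (trans (sym lvl) (n≤0⇒n≡0 (subst (d c a ≤_) (d-refl c) (⊑-level a⊑c)))) λ ())
        (m≤m+n _ _)
      where
      go : ∀ k x → Greedy x → ecc c ≤ k + d c x → ∃[ ℓ ] (Greedy ℓ × Childless ℓ)
      go k x greedy bound with Fin.any? (child? x)
      ... | no none = x , greedy , λ y ch → none (y , ch)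
      ... | yes some with minimiser (child? x) size some
      go zero x greedy bound | yes some | y , ch , _ =
        contradiction (≤-trans (d≤ecc c y) bound) (<⇒≱ (≤-reflexive (sym (proj₂ ch))))
      go (suc k) x greedy bound | yes some | y , ch , min = go k y greedy′
          (≤-trans bound (≤-reflexive (trans (sym (+-suc k _)) (cong (k +_) (sym (proj₂ ch))))))
        where
        greedy′ : Greedy y
        greedy′ {z} {a} {b} za a⊑y zb with ⊑-parent a⊑y ch
        ... | inj₂ a⊑x = greedy za a⊑x zb
        ... | inj₁ refl with parent-unique za ch
        ... | refl = min b zb

  -- Automorphisms after deletion of a leaf

  module Deletion {ℓ p} (pℓ : Child p ℓ) (childless : Childless ℓ) where

    leaf-neighbour : ∀ {w} → Edge G ℓ w → w ≡ p
    leaf-neighbour e with edge⇒child e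
    ... | inj₁ ch = contradiction ch (childless _)
    ... | inj₂ ch = parent-unique ch pℓ

    -- A shortest walk entering `ℓ` and going on would have to come from `p` and return to `p`.
    -- Hence geodesics between the remaining vertices survive the deletion.
    toward-≢-leaf : ∀ {x y z} → ℓ ≢ y → Edge G x z → suc (d z y) ≡ d x y → z ≢ ℓ
    toward-≢-leaf ℓ≢y e eq refl with toward ℓ≢y
    ... | q , e′ , eq′ with trans (leaf-neighbour e′) (sym (leaf-neighbour (edge-sym G e)))
    ... | refl = contradiction (trans (cong suc eq′) eq) (<⇒≢ (s≤s (n≤1+n _)) ∘ sym)

    -- An automorphism of the tree without `ℓ`, extended by fixing `ℓ`, so that the metric of the
    -- whole tree stays available.
    record AutomorphismOffLeaf (π : Permutation′ n) : Set where
      field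
        fixes-leaf : π ⟨$⟩ʳ ℓ ≡ ℓ
        preserves  : ∀ {x y} → x ≢ ℓ → y ≢ ℓ → adj G (π ⟨$⟩ʳ x) (π ⟨$⟩ʳ y) ≡ adj G x y

      avoids-leaf : ∀ {x} → x ≢ ℓ → π ⟨$⟩ʳ x ≢ ℓ
      avoids-leaf x≢ℓ eq = x≢ℓ (trans (sym (inverseˡ π))
        (trans (cong (π ⟨$⟩ˡ_) (trans eq (sym fixes-leaf))) (inverseˡ π)))

    open AutomorphismOffLeaf

    flip-automorphism : ∀ {π} → AutomorphismOffLeaf π → AutomorphismOffLeaf (flip π)
    flip-automorphism {π} A = record
      { fixes-leaf = fix
      ; preserves  = λ x≢ℓ y≢ℓ → trans
          (sym (preserves A (avoid x≢ℓ) (avoid y≢ℓ)))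
          (cong₂ (adj G) (inverseʳ π) (inverseʳ π)) }
      where
      fix : π ⟨$⟩ˡ ℓ ≡ ℓ
      fix = trans (cong (π ⟨$⟩ˡ_) (sym (fixes-leaf A))) (inverseˡ π)
      avoid : ∀ {x} → x ≢ ℓ → π ⟨$⟩ˡ x ≢ ℓ
      avoid x≢ℓ eq = x≢ℓ (trans (sym (inverseʳ π)) (trans (cong (π ⟨$⟩ʳ_) eq) (fixes-leaf A)))

    -- A geodesic between remaining vertices avoids `ℓ`, so its edges are carried to edges. Applied
    -- to the inverse as well, this gives `d-preserved`.
    d-contracts : ∀ {π} → AutomorphismOffLeaf π → ∀ {x y} → x ≢ ℓ → y ≢ ℓ →
                  d (π ⟨$⟩ʳ x) (π ⟨$⟩ʳ y) ≤ d x y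
    d-contracts {π} A {x} {y} x≢ℓ y≢ℓ = go _ refl x≢ℓ
      where
      go : ∀ k {x} → d x y ≡ k → x ≢ ℓ → d (π ⟨$⟩ʳ x) (π ⟨$⟩ʳ y) ≤ d x y
      go zero eq _ rewrite d≡0⇒≡ eq = ≤-trans (≤-reflexive (d-refl _)) z≤n
      go (suc k) {x} eq x≢ℓ with toward {x} {y} (λ { refl → 0≢1+n (trans (sym (d-refl y)) eq) })
      ... | z , e , eq′ = begin
          d (π ⟨$⟩ʳ x) (π ⟨$⟩ʳ y)       ≤⟨ d-step _ (trans (preserves A x≢ℓ z≢ℓ) e) ⟩
          suc (d (π ⟨$⟩ʳ z) (π ⟨$⟩ʳ y)) ≤⟨ s≤s (go k (suc-injective (trans eq′ eq)) z≢ℓ) ⟩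
          suc (d z y)                   ≡⟨ eq′ ⟩
          d x y                         ∎
        where
        open ≤-Reasoning
        z≢ℓ : z ≢ ℓ
        z≢ℓ = toward-≢-leaf (y≢ℓ ∘ sym) e eq′

    module _ {π} (A : AutomorphismOffLeaf π) where

      d-preserved : ∀ {x y} → x ≢ ℓ → y ≢ ℓ → d (π ⟨$⟩ʳ x) (π ⟨$⟩ʳ y) ≡ d x y
      d-preserved {x} {y} x≢ℓ y≢ℓ = ≤-antisym (d-contracts A x≢ℓ y≢ℓ)
        (subst₂ (λ u v → d u v ≤ d (π ⟨$⟩ʳ x) (π ⟨$⟩ʳ y)) (inverseˡ π) (inverseˡ π)
          (d-contracts (flip-automorphism A) (avoids-leaf A x≢ℓ) (avoids-leaf A y≢ℓ)))

      d-image-≤ : ∀ {z r} → z ≢ ℓ → (∀ y → y ≢ ℓ → d z y ≤ r) → ∀ y → y ≢ ℓ → d (π ⟨$⟩ʳ z) y ≤ r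
      d-image-≤ {z} {r} z≢ℓ le y y≢ℓ = subst (_≤ r)
        (trans (sym (d-preserved z≢ℓ y′≢ℓ)) (cong (d (π ⟨$⟩ʳ z)) (inverseʳ π))) (le _ y′≢ℓ)
        where
        y′≢ℓ : π ⟨$⟩ˡ y ≢ ℓ
        y′≢ℓ = avoids-leaf (flip-automorphism A) y≢ℓ

      -- The only edge at `ℓ` is the one to `p`, and both of its ends are fixed.
      parent-fixed⇒automorphism : π ⟨$⟩ʳ p ≡ p → IsAutomorphism G π
      parent-fixed⇒automorphism πp≡p = aut
        where
        leaf-adj : ∀ {y} → y ≢ p → adj G ℓ y ≡ false
        leaf-adj {y} y≢p = Bool.¬-not (y≢p ∘ leaf-neighbour)

        at-leaf : ∀ y → adj G (π ⟨$⟩ʳ ℓ) (π ⟨$⟩ʳ y) ≡ adj G ℓ y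
        at-leaf y with y Fin.≟ p
        ... | yes refl = cong₂ (adj G) (fixes-leaf A) πp≡p
        ... | no y≢p = trans (cong (λ u → adj G u (π ⟨$⟩ʳ y)) (fixes-leaf A))
          (trans (leaf-adj (λ eq → y≢p (trans (sym (inverseˡ π))
                    (trans (cong (π ⟨$⟩ˡ_) (trans eq (sym πp≡p))) (inverseˡ π)))))
                 (sym (leaf-adj y≢p)))

        aut : IsAutomorphism G π
        aut x y with x Fin.≟ ℓ | y Fin.≟ ℓ
        ... | yes refl | _        = at-leaf y
        ... | no _     | yes refl = trans (adj-sym G _ _) (trans (at-leaf x) (adj-sym G _ _))
        ... | no x≢ℓ   | no y≢ℓ   = preserves A x≢ℓ y≢ℓ

      module _ (greedy : Greedy ℓ) (c≢ℓ : c ≢ ℓ) (πc≡c : π ⟨$⟩ʳ c ≡ c) where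

        private
          level-preserved : ∀ {x} → x ≢ ℓ → d c (π ⟨$⟩ʳ x) ≡ d c x
          level-preserved {x} x≢ℓ = trans (cong (λ u → d u (π ⟨$⟩ʳ x)) (sym πc≡c)) (d-preserved c≢ℓ x≢ℓ)

          -- The weights of the whole tree are kept, so that sizes before and after the deletion of
          -- `ℓ` are comparable.
          contribution⁻ : Fin n → Fin n → ℕ
          contribution⁻ v w = if does (w Fin.≟ ℓ) then 0 else contribution v w

          size⁻ : Fin n → ℕ
          size⁻ v = sum (contribution⁻ v)

          at-ℓ : ∀ v → contribution⁻ v ℓ ≡ 0
          at-ℓ v rewrite dec-true (ℓ Fin.≟ ℓ) refl = refl

          off-ℓ : ∀ v {w} → w ≢ ℓ → contribution⁻ v w ≡ contribution v w
          off-ℓ v {w} w≢ℓ rewrite dec-false (w Fin.≟ ℓ) w≢ℓ = refl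

          size⁻-preserved : ∀ {v} → v ≢ ℓ → size⁻ (π ⟨$⟩ʳ v) ≡ size⁻ v
          size⁻-preserved {v} v≢ℓ = trans (sum-permute (contribution⁻ (π ⟨$⟩ʳ v)) π) (sum-cong-≗ same)
            where
            same : ∀ w → contribution⁻ (π ⟨$⟩ʳ v) (π ⟨$⟩ʳ w) ≡ contribution⁻ v w
            same w with w Fin.≟ ℓ
            ... | yes refl = trans (cong (contribution⁻ _) (fixes-leaf A)) (at-ℓ _)
            ... | no w≢ℓ = trans (off-ℓ _ (avoids-leaf A w≢ℓ))
              (same′ (level-preserved v≢ℓ) (d-preserved v≢ℓ w≢ℓ) (level-preserved w≢ℓ))
              where
              same′ : ∀ {i i′ j j′ k k′} → i ≡ i′ → j ≡ j′ → k ≡ k′ → term i j k ≡ term i′ j′ k′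
              same′ refl refl refl = refl

          size⁻-< : ∀ {v} → v ⊑ ℓ → size⁻ v < size v
          size⁻-< {v} v⊑ℓ = sum-mono-< le ℓ (subst₂ _<_ (sym (at-ℓ v)) (sym (contribution-⊑ v⊑ℓ)) (weight-pos (d v ℓ)))
            where
            le : ∀ w → contribution⁻ v w ≤ contribution v w
            le w with w Fin.≟ ℓ
            ... | yes refl = z≤n
            ... | no w≢ℓ   = ≤-refl

          size⁻-≡ : ∀ {v} → ¬ v ⊑ ℓ → size⁻ v ≡ size v
          size⁻-≡ {v} v⋢ℓ = sum-cong-≗ eq
            where
            eq : ∀ w → contribution⁻ v w ≡ contribution v w
            eq w with w Fin.≟ ℓ
            ... | yes refl = sym (contribution-⋢ v⋢ℓ)
            ... | no w≢ℓ   = refl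

        -- Deleting ℓ makes each ancestor of ℓ strictly smaller than all its siblings.
        ancestors-fixed : ∀ {x} → x ⊑ ℓ → x ≢ ℓ → π ⟨$⟩ʳ x ≡ x
        ancestors-fixed = go _ refl
          where
          go : ∀ k {x} → d c x ≡ k → x ⊑ ℓ → x ≢ ℓ → π ⟨$⟩ʳ x ≡ x
          go zero lvl _ _ rewrite sym (d≡0⇒≡ lvl) = πc≡c
          go (suc k) {x} lvl x⊑ℓ x≢ℓ with parent {x} (λ { refl → 0≢1+n (trans (sym (d-refl c)) lvl) })
          ... | z , zx with z Fin.≟ ℓ
          ... | yes refl = contradiction zx (childless x)
          ... | no z≢ℓ with π ⟨$⟩ʳ x Fin.≟ x
          ... | yes eq = eq
          ... | no πx≢x = contradiction (begin-strict
              size x             ≤⟨ greedy zx x⊑ℓ zπx ⟩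
              size (π ⟨$⟩ʳ x)    ≡⟨ size⁻-≡ (λ πx⊑ℓ → πx≢x (siblings-disjoint zπx zx πx⊑ℓ x⊑ℓ)) ⟨
              size⁻ (π ⟨$⟩ʳ x)   ≡⟨ size⁻-preserved x≢ℓ ⟩
              size⁻ x            <⟨ size⁻-< x⊑ℓ ⟩
              size x             ∎) (<-irrefl refl)
            where
            open ≤-Reasoning
            πz≡z : π ⟨$⟩ʳ z ≡ z
            πz≡z = go k (suc-injective (trans (sym (proj₂ zx)) lvl)) (between-trans (child-⊑ zx) x⊑ℓ) z≢ℓ
            zπx : Child z (π ⟨$⟩ʳ x)
            zπx = trans (cong (λ u → adj G u (π ⟨$⟩ʳ x)) (sym πz≡z)) (trans (preserves A z≢ℓ x≢ℓ) (proj₁ zx))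
                , trans (level-preserved x≢ℓ) (proj₂ zx)

        root-fixed⇒automorphism : IsAutomorphism G π
        root-fixed⇒automorphism = parent-fixed⇒automorphism
          (ancestors-fixed (child-⊑ pℓ) (λ { refl → edge-irrefl G (proj₁ pℓ) }))

-- Reflection of a path, and parity of distances

module Reflection {n} (G : Graph n) (tree : IsTree G) where
  open Metric G tree
  open Geodesics G tree
  open Centres G tree

  -- A tree whose distances to a are pairwise distinct is a path with end a.
  injective-levels⇒¬rigid : ∀ {a b} → a ≢ b → (∀ {x y} → d a x ≡ d a y → x ≡ y) → ¬ AutomorphismFree G
  injective-levels⇒¬rigid {a} {b} a≢b inj rigid = a≢b (d≡0⇒≡ (n≤0⇒n≡0 (begin
      d a b             ≤⟨ d≤ecc a b ⟩
      ecc a             ≡⟨ cong (ecc a ∸_) (d-refl a) ⟨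
      ecc a ∸ d a a     ≡⟨ level-τ a ⟨
      d a (τ a)         ≡⟨ cong (d a) (rigid π automorphism a) ⟩
      d a a             ≡⟨ d-refl a ⟩
      0                 ∎)))
    where
    open ≤-Reasoning

    -- The reflection exchanges level `k` with level `ecc a - k`. It sends `a` to level `ecc a`, so
    -- it could be trivial only if `ecc a` were zero.
    opposite : ∀ x → ∃[ y ] (d a y ≡ ecc a ∸ d a x × Between a y (far a))
    opposite x = geodesic-level (ecc a ∸ d a x) (m∸n≤m (ecc a) (d a x))

    τ : Fin n → Fin n
    τ x = proj₁ (opposite x)

    level-τ : ∀ x → d a (τ x) ≡ ecc a ∸ d a x
    level-τ x = proj₁ (proj₂ (opposite x))

    τ-involutive : ∀ x → τ (τ x) ≡ x
    τ-involutive x = inj (trans (level-τ (τ x))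
      (trans (cong (ecc a ∸_) (level-τ x)) (m∸[m∸n]≡n (d≤ecc a x))))

    π : Permutation′ n
    π = Perm.permutation τ τ τ-involutive τ-involutive

    -- The next vertex from `y` towards `a` has the level of `x`, hence is `x`.
    consecutive⇒edge : ∀ {x y} → suc (d a x) ≡ d a y → Edge G x y
    consecutive⇒edge {x} {y} eq with toward {y} {a} (λ { refl → 0≢1+n (trans (sym (d-refl y)) (sym eq)) })
    ... | u , e , eq′ with inj {u} {x} (trans (d-sym a u)
                             (suc-injective (trans eq′ (trans (d-sym y a) (sym eq)))))
    ... | refl = edge-sym G e

    consecutive-τ : ∀ {x y} → suc (d x a) ≡ d y a → suc (d a (τ y)) ≡ d a (τ x)
    consecutive-τ {x} {y} eq = begin-equality
        suc (d a (τ y))             ≡⟨ cong suc (level-τ y) ⟩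
        suc (ecc a ∸ d a y)         ≡⟨ +-∸-assoc 1 (d≤ecc a y) ⟨
        suc (ecc a) ∸ d a y         ≡⟨ cong (suc (ecc a) ∸_)
                                          (trans (d-sym a y) (trans (sym eq) (cong suc (d-sym x a)))) ⟩
        suc (ecc a) ∸ suc (d a x)   ≡⟨⟩
        ecc a ∸ d a x               ≡⟨ level-τ x ⟨
        d a (τ x)                   ∎

    edge-τ : ∀ {x y} → Edge G x y → Edge G (τ x) (τ y)
    edge-τ {x} {y} e with edge-cases a e
    ... | inj₁ q = edge-sym G (consecutive⇒edge (consecutive-τ q))
    ... | inj₂ q = consecutive⇒edge (consecutive-τ q)

    automorphism : IsAutomorphism G π
    automorphism x y = Bool.⇔→≡ (mk⇔
      (λ e → subst₂ (Edge G) (τ-involutive x) (τ-involutive y) (edge-τ e)) edge-τ)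

  -- Moving `y` one step towards `z` lowers `d y z` by one and changes `d x y` by exactly one, so
  -- the sum drops by two or not at all until `y` reaches `z`.
  distance-parity : ∀ x y z → ∃[ m ] d x y + d y z ≡ d x z + (m + m)
  distance-parity x y z = go _ refl
    where
    open ≡-Reasoning
    go : ∀ k {y} → d y z ≡ k → ∃[ m ] d x y + d y z ≡ d x z + (m + m)
    go zero eq rewrite d≡0⇒≡ eq = 0 , cong (d x z +_) (d-refl z)
    go (suc k) {y} eq with toward {y} {z} (λ { refl → 0≢1+n (trans (sym (d-refl y)) eq) })
    ... | u , e , eq′ with go k (suc-injective (trans eq′ eq)) | edge-cases x e
    ... | m , ih | inj₁ q = m , (begin
      d x y + d y z         ≡⟨ cong (d x y +_) eq′ ⟨
      d x y + suc (d u z)   ≡⟨ +-suc _ _ ⟩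
      suc (d x y) + d u z   ≡⟨ cong (_+ d u z) (trans (cong suc (d-sym x y)) (trans q (d-sym u x))) ⟩
      d x u + d u z         ≡⟨ ih ⟩
      d x z + (m + m)       ∎)
    ... | m , ih | inj₂ q = suc m , (begin
      d x y + d y z               ≡⟨ cong₂ _+_
                                      (trans (d-sym x y) (trans (sym q) (cong suc (d-sym u x)))) (sym eq′) ⟩
      suc (d x u) + suc (d u z)   ≡⟨ cong suc (+-suc _ _) ⟩
      2 + (d x u + d u z)         ≡⟨ cong (2 +_) ih ⟩
      2 + (d x z + (m + m))       ≡⟨ cong suc (+-suc _ _) ⟨
      suc (d x z + suc (m + m))   ≡⟨ +-suc _ _ ⟨
      d x z + suc (suc (m + m))   ≡⟨ cong (λ k → d x z + suc k) (+-suc m m) ⟨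
      d x z + (suc m + suc m)     ∎)

m+m≢1 : ∀ m → m + m ≢ 1
m+m≢1 (suc m) eq = 1+n≢0 (trans (sym (+-suc m m)) (suc-injective eq))

-- The case in which every pair at distance `2r` contains the deleted leaf

module CentreRooted {n} (G : Graph n) (tree : IsTree G) (c : Fin n) where
  open Metric G tree
  open Geodesics G tree
  open Centres G tree
  open Rooted G tree c
  open Reflection G tree

  module PathBranch
    {ℓ p} (pℓ : Child p ℓ) (childless : Childless ℓ) (greedy : Greedy ℓ) (c≢ℓ : c ≢ ℓ)
    {w} (w≢ℓ : w ≢ ℓ) (c≢w : c ≢ w) (ℓ-c-w : Between ℓ c w) (ℓ-far : d c ℓ ≡ ecc c) (w-far : d c w ≡ ecc c)
    (no-other-pair : ∀ {x y} → x ≢ ℓ → y ≢ ℓ → d x y ≢ ecc c + ecc c)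
    where
    open Deletion pℓ childless
    open AutomorphismOffLeaf

    private
      r = ecc c
      -- This neighbour of `c` becomes the second centre once `ℓ` is deleted; `v ⊑ x` tells the side
      -- of `w` from the side of `ℓ` across the edge `c v`.
      v = proj₁ (toward c≢w)
      cv = proj₁ (proj₂ (toward c≢w))
      v-w = proj₂ (proj₂ (toward c≢w))

      c-root : ∀ {u} → ¬ Child u c
      c-root (_ , eq) = 0≢1+n (trans (sym (d-refl c)) eq)

      child-cv : Child c v
      child-cv = [ (λ ch → ch) , (λ ch → contradiction ch c-root) ]′ (edge⇒child cv)

      level-v : d c v ≡ 1
      level-v = trans (proj₂ child-cv) (cong suc (d-refl c))

      below : ∀ {x} → v ⊑ x → suc (d v x) ≡ d c x
      below {x} = trans (cong (_+ d v x) (sym level-v))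

      above : ∀ {x} → ¬ v ⊑ x → suc (d c x) ≡ d v x
      above {x} v⋢x with edge-cases x cv
      ... | inj₁ q = q
      ... | inj₂ q = contradiction (trans (cong (_+ d v x) level-v) q) v⋢x

      across : ∀ {x y} → v ⊑ x → ¬ v ⊑ y → Between x c y
      across v⊑x v⋢y = between-glue cv (below v⊑x) (above v⋢y)

      v⋢ℓ : ¬ v ⊑ ℓ
      v⋢ℓ v⊑ℓ = contradiction (begin-strict
        d ℓ c + d c w               ≡⟨ ℓ-c-w ⟩
        d ℓ w                       ≤⟨ d-triangle ℓ v w ⟩
        d ℓ v + d v w               ≡⟨ cong (_+ d v w) (d-sym ℓ v) ⟩
        d v ℓ + d v w               <⟨ +-mono-<-≤ ≤-refl (n≤1+n _) ⟩
        suc (d v ℓ) + suc (d v w)   ≡⟨ cong₂ _+_ (trans (below v⊑ℓ) (d-sym c ℓ)) v-w ⟩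
        d ℓ c + d c w               ∎) (<-irrefl refl)
        where open ≤-Reasoning

      v≢ℓ : v ≢ ℓ
      v≢ℓ eq = v⋢ℓ (subst (v ⊑_) eq (⊑-refl v))

      v⊑w : v ⊑ w
      v⊑w = trans (cong (_+ d v w) level-v) v-w

      -- Any such `y` other than `ℓ` would form with `w` a pair at distance `2r` avoiding `ℓ`.
      far-above : ∀ {y} → ¬ v ⊑ y → d c y ≡ r → y ≡ ℓ
      far-above {y} v⋢y y-far with y Fin.≟ ℓ
      ... | yes eq = eq
      ... | no y≢ℓ = contradiction
        (trans (sym (across v⊑w v⋢y)) (cong₂ _+_ (trans (d-sym w c) w-far) y-far)) (no-other-pair w≢ℓ y≢ℓ)

      divergence : ∀ {x} → ¬ x ⊑ ℓ → ∃[ z ] ∃[ b ] (z ⊑ ℓ × Child z b × ¬ b ⊑ ℓ × b ⊑ x)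
      divergence = go _ refl
        where
        go : ∀ k {x} → d c x ≡ k → ¬ x ⊑ ℓ → ∃[ z ] ∃[ b ] (z ⊑ ℓ × Child z b × ¬ b ⊑ ℓ × b ⊑ x)
        go zero eq x⋢ℓ = contradiction (subst (_⊑ ℓ) (d≡0⇒≡ eq) (root-⊑ ℓ)) x⋢ℓ
        go (suc k) {x} eq x⋢ℓ with parent {x} (λ { refl → x⋢ℓ (root-⊑ ℓ) })
        ... | z , zx with z ⊑? ℓ
        ... | yes z⊑ℓ = z , x , z⊑ℓ , zx , x⋢ℓ , ⊑-refl x
        ... | no z⋢ℓ with go k (suc-injective (trans (sym (proj₂ zx)) eq)) z⋢ℓ
        ... | z′ , b , z′⊑ℓ , ch , b⋢ℓ , b⊑z = z′ , b , z′⊑ℓ , ch , b⋢ℓ , between-trans b⊑z (child-⊑ zx)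

      -- A branch leaving the path from c to ℓ is at least as large, hence at least as high, as the
      -- rest of that path; it would contain a vertex at distance r from c other than ℓ.
      above-chain : ∀ {x} → ¬ v ⊑ x → x ⊑ ℓ
      above-chain {x} v⋢x with x ⊑? ℓ
      ... | yes x⊑ℓ = x⊑ℓ
      ... | no x⋢ℓ with divergence x⋢ℓ
      ... | z , b , z⊑ℓ , zb , b⋢ℓ , b⊑x with z Fin.≟ ℓ
      ... | yes refl = contradiction zb (childless b)
      ... | no z≢ℓ with child-toward z⊑ℓ z≢ℓ
      ... | a , za , a⊑ℓ with size-≤⇒height-≤ (greedy za a⊑ℓ zb) a⊑ℓ
      ... | y , b⊑y , le = contradiction (far-above v⋢y y-far) (λ { refl → b⋢ℓ b⊑y })
        where
        open ≤-Reasoning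
        v⋢y : ¬ v ⊑ y
        v⋢y v⊑y = v⋢x (between-trans (between-comparable v⊑y b⊑y
          (subst₂ _≤_ (sym level-v) (sym (proj₂ zb)) (s≤s z≤n))) b⊑x)
        y-far : d c y ≡ r
        y-far = ≤-antisym (d≤ecc c y) (begin
          r               ≡⟨ ℓ-far ⟨
          d c ℓ           ≡⟨ a⊑ℓ ⟨
          d c a + d a ℓ   ≡⟨ cong (_+ d a ℓ) (trans (proj₂ za) (sym (proj₂ zb))) ⟩
          d c b + d a ℓ   ≤⟨ +-monoʳ-≤ (d c b) le ⟩
          d c b + d b y   ≡⟨ b⊑y ⟩
          d c y           ∎)

      -- Below `v`, distances drop by one in passing from `c` to `v`. Elsewhere they grow by one,
      -- but there only `ℓ` is at distance `r` from `c`.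
      v-bound : ∀ y → y ≢ ℓ → d v y ≤ r
      v-bound y y≢ℓ with v ⊑? y
      ... | yes v⊑y = ≤-trans (n≤1+n _) (≤-trans (≤-reflexive (below v⊑y)) (d≤ecc c y))
      ... | no v⋢y = ≤-trans (≤-reflexive (sym (above v⋢y)))
        (≤∧≢⇒< (d≤ecc c y) (λ eq → y≢ℓ (far-above v⋢y eq)))

      v⋢p : ¬ v ⊑ p
      v⋢p v⊑p = v⋢ℓ (between-trans v⊑p (child-⊑ pℓ))

      level-p : suc (d p c) ≡ r
      level-p = trans (cong suc (d-sym p c)) (trans (sym (proj₂ pℓ)) ℓ-far)

      p-c-w : Between p c w
      p-c-w = begin
        d p c + d c w ≡⟨ +-comm (d p c) _ ⟩
        d c w + d p c ≡⟨ cong₂ _+_ (d-sym c w) (d-sym p c) ⟩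
        d w c + d c p ≡⟨ across v⊑w v⋢p ⟩
        d w p         ≡⟨ d-sym w p ⟩
        d p w         ∎
        where open ≡-Reasoning

      -- Without `ℓ`, the path from `p` to `w` has odd length `2r - 1`, and its two middle vertices
      -- are `c` and `v`.
      suc-d-p-w : suc (d p w) ≡ r + r
      suc-d-p-w = trans (cong suc (sym p-c-w)) (cong₂ _+_ level-p w-far)

      d-p-v : d p v ≡ r
      d-p-v = trans (d-sym p v) (trans (sym (above v⋢p)) (trans (cong suc (d-sym c p)) level-p))

      p-v-w : Between p v w
      p-v-w = suc-injective (trans (sym (+-suc _ _)) (trans (cong₂ _+_ d-p-v (trans v-w w-far)) (sym suc-d-p-w)))

      -- c and v are the only centres of the tree without ℓ.
      remaining-centres : ∀ {z} → (∀ y → y ≢ ℓ → d z y ≤ r) → z ≡ c ⊎ z ≡ v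
      remaining-centres {z} bound with m≤n⇒m<n∨m≡n p≤r | m≤n⇒m<n∨m≡n w≤r
        where
        p≤r : d p z ≤ r
        p≤r = subst (_≤ r) (d-sym z p) (bound p (λ { refl → edge-irrefl G (proj₁ pℓ) }))
        w≤r : d z w ≤ r
        w≤r = bound w w≢ℓ
      -- Both distances of `z` are at most `r` and add up to at least `2r - 1`. If the one to `p` is
      -- below `r`, the pair is `r - 1` and `r`, as for `c`; the symmetric case gives `v`.
      ... | inj₁ p<r | w≤r with +-squeeze p<r ([ <⇒≤ , ≤-reflexive ]′ w≤r)
                                  (≤-trans (≤-reflexive (sym suc-d-p-w)) (s≤s (d-triangle p z w)))
      ... | eq₁ , eq₂ = inj₁ (sym (geodesic-point-unique p-c-w
              (suc-injective (trans level-p (sym eq₁))) (trans w-far (sym eq₂))))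
      remaining-centres {z} bound | inj₂ p≡r | inj₁ w<r with +-squeeze (≤-reflexive p≡r) w<r
            (≤-trans (≤-reflexive (sym suc-d-p-w)) (≤-trans (s≤s (d-triangle p z w)) (≤-reflexive (sym (+-suc _ _)))))
      ... | eq₁ , eq₂ = inj₂ (sym (geodesic-point-unique p-v-w
              (trans d-p-v (sym eq₁)) (suc-injective (trans v-w (trans w-far (sym eq₂))))))
      -- Two distances `r` would exceed `d p w` by one, whereas the excess is even.
      remaining-centres {z} bound | inj₂ p≡r | inj₂ w≡r with distance-parity p z w
      ... | m , eq = contradiction
        (+-cancelˡ-≡ (d p w) (m + m) 1
          (trans (sym eq) (trans (cong₂ _+_ p≡r w≡r) (trans (sym suc-d-p-w) (+-comm 1 _)))))
        (m+m≢1 m)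

    module _ {π} (A : AutomorphismOffLeaf π) where

      private
        module _ (πc≡v : π ⟨$⟩ʳ c ≡ v) where

          πv≡c : π ⟨$⟩ʳ v ≡ c
          πv≡c with remaining-centres (d-image-≤ A v≢ℓ v-bound)
          ... | inj₁ eq = eq
          ... | inj₂ eq = contradiction (subst (Edge G c) (sym c≡v) cv) (edge-irrefl G)
            where
            c≡v : c ≡ v
            c≡v = trans (sym (inverseˡ π)) (trans (cong (π ⟨$⟩ˡ_) (trans πc≡v (sym eq))) (inverseˡ π))

          below-≢ℓ : ∀ {x} → v ⊑ x → x ≢ ℓ
          below-≢ℓ v⊑x refl = v⋢ℓ v⊑x

          level-image : ∀ {x} → v ⊑ x → d c (π ⟨$⟩ʳ x) ≡ d v x
          level-image {x} v⊑x = trans (cong (λ u → d u (π ⟨$⟩ʳ x)) (sym πv≡c)) (d-preserved A v≢ℓ (below-≢ℓ v⊑x))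

          -- As `π` exchanges `c` and `v`, it exchanges the distances to them, so the image of a
          -- vertex nearer to `v` is nearer to `c`.
          image-above : ∀ {x} → v ⊑ x → ¬ v ⊑ π ⟨$⟩ʳ x
          image-above {x} v⊑x v⊑πx = <⇒≢ (s≤s (n≤1+n _)) (sym (begin
            suc (suc (d v x))                   ≡⟨ cong suc (below v⊑x) ⟩
            suc (d c x)                         ≡⟨ cong suc (d-preserved A c≢ℓ (below-≢ℓ v⊑x)) ⟨
            suc (d (π ⟨$⟩ʳ c) (π ⟨$⟩ʳ x))       ≡⟨ cong (λ u → suc (d u (π ⟨$⟩ʳ x))) πc≡v ⟩
            suc (d v (π ⟨$⟩ʳ x))                ≡⟨ below v⊑πx ⟩
            d c (π ⟨$⟩ʳ x)                      ≡⟨ level-image v⊑x ⟩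
            d v x                               ∎))
            where open ≡-Reasoning

          across-ℓ : ∀ {x} → v ⊑ x → d ℓ x ≡ d c x + r
          across-ℓ {x} v⊑x = trans (d-sym ℓ x) (trans (sym (across v⊑x v⋢ℓ)) (cong₂ _+_ (d-sym x c) ℓ-far))

          -- The images lie on the path from `c` to `ℓ` by `above-chain`, where the level determines
          -- the vertex.
          below-level-injective : ∀ {x y} → v ⊑ x → v ⊑ y → d c x ≡ d c y → x ≡ y
          below-level-injective {x} {y} v⊑x v⊑y eq =
            trans (sym (inverseˡ π)) (trans (cong (π ⟨$⟩ˡ_) πx≡πy) (inverseˡ π))
            where
            πx≡πy : π ⟨$⟩ʳ x ≡ π ⟨$⟩ʳ y
            πx≡πy = ⊑-point-unique (above-chain (image-above v⊑x)) (above-chain (image-above v⊑y))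
              (trans (level-image v⊑x) (trans
                (suc-injective (trans (below v⊑x) (trans eq (sym (below v⊑y))))) (sym (level-image v⊑y))))

          -- On the side of `c` the distance to `ℓ` is at most `r`; below `v` it exceeds `r`.
          separated : ∀ {x y} → v ⊑ x → ¬ v ⊑ y → d ℓ x ≢ d ℓ y
          separated {x} {y} v⊑x v⋢y eq = <-irrefl refl (begin-strict
            d ℓ y           ≡⟨ d-sym ℓ y ⟩
            d y ℓ           ≤⟨ m≤n+m _ (d c y) ⟩
            d c y + d y ℓ   ≡⟨ above-chain v⋢y ⟩
            d c ℓ           ≡⟨ ℓ-far ⟩
            r               <⟨ +-monoˡ-≤ r (subst (1 ≤_) (below v⊑x) (s≤s z≤n)) ⟩
            d c x + r       ≡⟨ across-ℓ v⊑x ⟨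
            d ℓ x           ≡⟨ eq ⟩
            d ℓ y           ∎)
            where open ≤-Reasoning

          levels-injective : ∀ {x y} → d ℓ x ≡ d ℓ y → x ≡ y
          levels-injective {x} {y} eq with v ⊑? x | v ⊑? y
          ... | yes v⊑x | yes v⊑y = below-level-injective v⊑x v⊑y
                (+-cancelʳ-≡ r _ _ (trans (sym (across-ℓ v⊑x)) (trans eq (across-ℓ v⊑y))))
          ... | yes v⊑x | no v⋢y  = contradiction eq (separated v⊑x v⋢y)
          ... | no v⋢x  | yes v⊑y = contradiction (sym eq) (separated v⊑y v⋢x)
          ... | no v⋢x  | no v⋢y  = ⊑-point-unique (above-chain v⋢x) (above-chain v⋢y)
                (+-cancelʳ-≡ (d x ℓ) _ _ (trans (above-chain v⋢x) (trans (sym (above-chain v⋢y))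
                  (cong (d c y +_) (trans (d-sym y ℓ) (trans (sym eq) (d-sym ℓ x)))))))

      -- If π exchanged the two centres c and v of the tree without ℓ, both sides would be paths.
      path-branch⇒root-fixed : AutomorphismFree G → π ⟨$⟩ʳ c ≡ c
      path-branch⇒root-fixed rigid with remaining-centres (d-image-≤ A c≢ℓ (λ y _ → d≤ecc c y))
      ... | inj₁ eq = eq
      ... | inj₂ eq = contradiction rigid (injective-levels⇒¬rigid (c≢ℓ ∘ sym) (levels-injective eq))

-- Cycles after vertex deletion, and a vertex count

module _ {m} (G : Graph (suc m)) where

  deleteVertex-walk : ∀ {ℓ u w vs} → Walk (deleteVertex G ℓ) u w vs →
                      Walk G (punchIn ℓ u) (punchIn ℓ w) (map (punchIn ℓ) vs)
  deleteVertex-walk here       = here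
  deleteVertex-walk (step e w) = step e (deleteVertex-walk w)

  deleteVertex-acyclic : ∀ ℓ → ¬ HasCycle G → ¬ HasCycle (deleteVertex G ℓ)
  deleteVertex-acyclic ℓ acyc (u , w , vs , walk , unique , 3≤ , e) =
    acyc (_ , _ , _ , deleteVertex-walk walk , Unique.map⁺ (Fin.punchIn-injective ℓ _ _) unique
         , subst (3 ≤_) (sym (length-map (punchIn ℓ) vs)) 3≤ , e)

distinct-triple⇒3≤ : ∀ {n} {x y z : Fin n} → x ≢ y → x ≢ z → y ≢ z → 3 ≤ n
distinct-triple⇒3≤ {n} {x} {y} {z} x≢y x≢z y≢z = Fin.injective⇒≤ {f = f} (λ {i} {j} → inj i j)
  where
  f : Fin 3 → Fin n
  f zero             = x
  f (suc zero)       = y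
  f (suc (suc zero)) = z
  inj : ∀ i j → f i ≡ f j → i ≡ j
  inj zero             zero             _  = refl
  inj zero             (suc zero)       eq = contradiction eq x≢y
  inj zero             (suc (suc zero)) eq = contradiction eq x≢z
  inj (suc zero)       zero             eq = contradiction (sym eq) x≢y
  inj (suc zero)       (suc zero)       _  = refl
  inj (suc zero)       (suc (suc zero)) eq = contradiction eq y≢z
  inj (suc (suc zero)) zero             eq = contradiction (sym eq) x≢z
  inj (suc (suc zero)) (suc zero)       eq = contradiction (sym eq) y≢z
  inj (suc (suc zero)) (suc (suc zero)) _  = refl

-- The greedy leaf can be deleted

module Deletable {m} (G : Graph (suc m)) (tree : IsTree G) (rigid : AutomorphismFree G) (c : Fin (suc m)) where
  open Metric G tree
  open Geodesics G tree
  open Centres G tree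
  open Rooted G tree c
  open CentreRooted G tree c

  module _ {w₀ w₁} (c≢w₀ : c ≢ w₀) (w₀-c-w₁ : Between w₀ c w₁)
           (w₀-far : d c w₀ ≡ ecc c) (w₁-far : d c w₁ ≡ ecc c) where

    private
      r = ecc c

      0<r : 0 < r
      0<r = subst (0 <_) w₀-far (n≢0⇒n>0 (c≢w₀ ∘ d≡0⇒≡))

      c≢w₁ : c ≢ w₁
      c≢w₁ refl = <-irrefl (trans (sym (d-refl c)) w₁-far) 0<r

      d-w₀-w₁ : d w₀ w₁ ≡ r + r
      d-w₀-w₁ = trans (sym w₀-c-w₁) (cong₂ _+_ (trans (d-sym w₀ c) w₀-far) w₁-far)

      w₀≢w₁ : w₀ ≢ w₁
      w₀≢w₁ refl = <-irrefl (trans (sym (d-refl w₀)) d-w₀-w₁) (≤-trans 0<r (m≤m+n r r))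

      w₁-c-w₀ : Between w₁ c w₀
      w₁-c-w₀ = trans (+-comm (d w₁ c) _)
        (trans (cong₂ _+_ (d-sym c w₀) (d-sym w₁ c)) (trans w₀-c-w₁ (d-sym w₀ w₁)))

      ℓ = proj₁ greedy-descent
      greedy = proj₁ (proj₂ greedy-descent)
      childless = proj₂ (proj₂ greedy-descent)

      c≢ℓ : c ≢ ℓ
      c≢ℓ eq with child-toward (root-⊑ w₀) c≢w₀
      ... | v , cv , _ = childless v (subst (λ u → Child u v) eq cv)

      p = proj₁ (parent (c≢ℓ ∘ sym))
      pℓ = proj₂ (parent (c≢ℓ ∘ sym))

      open Deletion pℓ childless
      open AutomorphismOffLeaf

      midpoint : ∀ {x y z} → d x y ≡ r + r → d x z ≤ r → d z y ≤ r → d x z ≡ r × d z y ≡ r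
      midpoint {x} {y} {z} eq p q = +-squeeze p q (≤-trans (≤-reflexive (sym eq)) (d-triangle x z y))

      -- Both `c` and its image are within `r` of `x` and of `y`, so each is the midpoint of the
      -- path between them.
      diametral-pair⇒root-fixed : ∀ {π x y} → AutomorphismOffLeaf π → x ≢ ℓ → y ≢ ℓ →
                                  d x y ≡ r + r → π ⟨$⟩ʳ c ≡ c
      diametral-pair⇒root-fixed {π} {x} {y} A x≢ℓ y≢ℓ eq
        with midpoint {z = c} eq (subst (_≤ r) (d-sym c x) (d≤ecc c x)) (d≤ecc c y)
           | midpoint {z = π ⟨$⟩ʳ c} eq (subst (_≤ r) (d-sym _ x) (bound x x≢ℓ)) (bound y y≢ℓ)
        where
        bound : ∀ y → y ≢ ℓ → d (π ⟨$⟩ʳ c) y ≤ r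
        bound = d-image-≤ A c≢ℓ (λ y _ → d≤ecc c y)
      ... | xc , cy | xz , zy = sym (geodesic-point-unique
            (trans (cong₂ _+_ xc cy) (sym eq)) (trans xc (sym xz)) (trans cy (sym zy)))

      root-fixed : ∀ {π} → AutomorphismOffLeaf π → π ⟨$⟩ʳ c ≡ c
      root-fixed A with Fin.any? (λ x → Fin.any? (λ y →
        ¬? (x Fin.≟ ℓ) ×-dec ¬? (y Fin.≟ ℓ) ×-dec d x y ≟ r + r))
      ... | yes (x , y , x≢ℓ , y≢ℓ , eq) = diametral-pair⇒root-fixed A x≢ℓ y≢ℓ eq
      -- With no such pair off `ℓ`, one of `w₀` and `w₁` is `ℓ`, and the other serves as the `w` of
      -- `PathBranch`.
      ... | no none with w₀ Fin.≟ ℓ | w₁ Fin.≟ ℓ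
      ... | no w₀≢ℓ  | no w₁≢ℓ = contradiction (w₀ , w₁ , w₀≢ℓ , w₁≢ℓ , d-w₀-w₁) none
      ... | yes refl | _        =
        PathBranch.path-branch⇒root-fixed pℓ childless greedy c≢ℓ (w₀≢w₁ ∘ sym) c≢w₁ w₀-c-w₁ w₀-far w₁-far
          (λ x≢ℓ y≢ℓ eq → none (_ , _ , x≢ℓ , y≢ℓ , eq)) A rigid
      ... | no _     | yes refl =
        PathBranch.path-branch⇒root-fixed pℓ childless greedy c≢ℓ w₀≢w₁ c≢w₀ w₁-c-w₀ w₁-far w₀-far
          (λ x≢ℓ y≢ℓ eq → none (_ , _ , x≢ℓ , y≢ℓ , eq)) A rigid

      T⁻ = deleteVertex G ℓ

      connected⁻ : Connected T⁻
      connected⁻ u w = go _ refl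
        where
        go : ∀ k {u} → d (punchIn ℓ u) (punchIn ℓ w) ≡ k → ∃[ vs ] Walk T⁻ u w vs
        go zero {u} eq with refl ← Fin.punchIn-injective ℓ u w (d≡0⇒≡ eq) = _ , here
        go (suc k) {u} eq with toward {punchIn ℓ u} {punchIn ℓ w}
                                 (λ eq′ → 0≢1+n (trans (sym (trans (cong (λ x → d x _) eq′) (d-refl _))) eq))
        ... | z , e , eq′ = _ , step
              (subst (Edge G (punchIn ℓ u)) (sym z′≡z) e)
              (proj₂ (go k (trans (cong (λ x → d x _) z′≡z) (suc-injective (trans eq′ eq)))))
          where
          ℓ≢z : ℓ ≢ z
          ℓ≢z = toward-≢-leaf (Fin.punchInᵢ≢i ℓ w ∘ sym) e eq′ ∘ sym
          z′≡z : punchIn ℓ (punchOut ℓ≢z) ≡ z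
          z′≡z = Fin.punchIn-punchOut ℓ≢z

      module _ (σ : Permutation′ m) (aut : IsAutomorphism T⁻ σ) where

        extension : Permutation′ (suc m)
        extension = Perm.insert ℓ ℓ σ

        extension-punchIn : ∀ i → extension ⟨$⟩ʳ punchIn ℓ i ≡ punchIn ℓ (σ ⟨$⟩ʳ i)
        extension-punchIn = Perm.insert-punchIn ℓ ℓ σ

        extension-off-leaf : AutomorphismOffLeaf extension
        extension-off-leaf = record { fixes-leaf = fixed ; preserves = pres }
          where
          fixed : extension ⟨$⟩ʳ ℓ ≡ ℓ
          fixed with ℓ Fin.≟ ℓ
          ... | yes _  = refl
          ... | no ℓ≢ℓ = contradiction refl ℓ≢ℓ
          pres : ∀ {x y} → x ≢ ℓ → y ≢ ℓ → adj G (extension ⟨$⟩ʳ x) (extension ⟨$⟩ʳ y) ≡ adj G x y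
          pres x≢ℓ y≢ℓ = subst₂ (λ x y → adj G (extension ⟨$⟩ʳ x) (extension ⟨$⟩ʳ y) ≡ adj G x y)
            (Fin.punchIn-punchOut (x≢ℓ ∘ sym)) (Fin.punchIn-punchOut (y≢ℓ ∘ sym))
            (trans (cong₂ (adj G) (extension-punchIn _) (extension-punchIn _)) (aut _ _))

        identity : ∀ i → σ ⟨$⟩ʳ i ≡ i
        identity i = Fin.punchIn-injective ℓ _ _ (trans (sym (extension-punchIn i))
          (rigid extension
            (root-fixed⇒automorphism extension-off-leaf greedy c≢ℓ (root-fixed extension-off-leaf))
            (punchIn ℓ i)))

    deletable-leaf : ∃[ ℓ ] (IsLeaf G ℓ × IsAFT (deleteVertex G ℓ))
    deletable-leaf = ℓ , (p , edge-sym G (proj₁ pℓ) , λ _ → leaf-neighbour)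
      -- The vertices `c`, `w₀` and `w₁` are distinct, so at least two vertices remain.
      , ≤-pred (distinct-triple⇒3≤ c≢w₀ c≢w₁ w₀≢w₁)
      , (connected⁻ , deleteVertex-acyclic G ℓ (proj₂ tree))
      , identity

-- Conclusion

another-vertex : ∀ {n} → 2 ≤ n → (v : Fin n) → ∃[ w ] w ≢ v
another-vertex (s≤s (s≤s _)) zero    = suc zero , λ ()
another-vertex (s≤s (s≤s _)) (suc v) = zero , λ ()

theorem2p3 : ∀ {n : ℕ} (T : Graph n) → MinimalAFT T → HasTwoCenters T
theorem2p3 {suc m} T ((2≤n , tree , rigid) , minimal) = conclude (Centres.central-vertex T tree zero)
  where
  open Centres T tree
  conclude : ∃ Central → HasTwoCenters T
  conclude (c , central) with two-centres-or-diametral-pair (another-vertex 2≤n) central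
  ... | inj₁ two = two
  ... | inj₂ (_ , btw , w₁-far)
    with ℓ , leaf , aft ← Deletable.deletable-leaf T tree rigid c
                            (far≢ (another-vertex 2≤n) central) btw refl w₁-far
    -- Minimality would make `T` isomorphic to a tree with one vertex fewer.
    = contradiction
        (Perm.↔⇒≡ (proj₁ (minimal (deleteVertex T ℓ) aft
          (⪯-del ℓ leaf aft (⪯-iso (Perm.id , λ _ _ → refl))))))
        (<⇒≢ (n<1+n m))
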